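{- For any $0<\varepsilon<1/2$ and any real $1\le R<\varepsilon^{ -1}-1$, there is a weighted graph $G$ such that, for every family $\mathcal I=\{[\ell_i,r_i]\}_i$ of intervals $[\ell_i,r_i]\subseteq\mathbb R_{>0}$ satisfying $r_i/\ell_i\le R$ for every $i$, one can choose a maximum-weight matching $M_i$ of $G[\ell_i,r_i]$ for each $i$ so that $$\mu_w\!\left(\bigcup_i M_i\right)<(1-\varepsilon)\mu_w(G).$$
   Context: Weighted graphs have positive real edge weights. $\mu_w(F)$ is the maximum weight of a matching in a weighted graph (or contained in an edge set) $F$, zero if $F$ has no edges. $G[\ell,r]$ is the subgraph of $G$ that contains all edges of $G$ with weights in $[\ell,r]$. -}

module Defs where

open import Algebra.Bundles using (CommutativeRing)
open import Axiom.ExcludedMiddle using (ExcludedMiddle)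
open import Data.Bool.Base using (if_then_else_)
open import Data.Empty using (⊥-elim)
open import Data.Fin.Base as Fin using (Fin)
open import Data.Fin.Subset using (Subset; _∈_; inside; outside)
open import Data.Fin.Subset.Properties using (∉⊥)
open import Data.Nat.Base using (ℕ; zero; suc)
open import Data.Product.Base using (∃; _×_; _,_; proj₁; proj₂)
open import Data.Sum.Base using (_⊎_; inj₁; inj₂)
open import Data.Vec.Base using ([]; _∷_; lookup)
open import Function.Definitions using (Injective)
open import Level using (Level; _⊔_) renaming (suc to lsuc)
open import Relation.Binary.Core using (Rel)
open import Relation.Binary.PropositionalEquality.Core using (_≡_)
open import Relation.Binary.Structures using (IsTotalOrder)
open import Relation.Nullary using (¬_; yes; no)
open import Relation.Unary using (Pred)
import Data.Fin.Subset as Subset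
import Algebra.Properties.Monoid.Sum as Sum
import Relation.Binary.Construct.NonStrictToStrict as NonStrictToStrict

-- The real numbers, characterised as a Dedekind-complete ordered field
-- (classically unique up to isomorphism).  The inverse is a total
-- function; its value at zero is unspecified.

record Reals (c ℓ₁ ℓ₂ : Level) : Set (lsuc (c ⊔ ℓ₁ ⊔ ℓ₂)) where
  infix  4 _≤_
  infix  8 _⁻¹
  field
    commutativeRing : CommutativeRing c ℓ₁

  open CommutativeRing commutativeRing public

  field
    _⁻¹          : Carrier → Carrier
    ⁻¹-cong      : ∀ {x y} → x ≈ y → x ⁻¹ ≈ y ⁻¹
    *-inverseʳ   : ∀ {x} → ¬ x ≈ 0# → x * x ⁻¹ ≈ 1#
    1≉0          : ¬ 1# ≈ 0#

    _≤_          : Rel Carrier ℓ₂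
    isTotalOrder : IsTotalOrder _≈_ _≤_
    +-monoˡ-≤    : ∀ z {x y} → x ≤ y → x + z ≤ y + z
    *-nonNeg     : ∀ {x y} → 0# ≤ x → 0# ≤ y → 0# ≤ x * y

  IsUpperBound : Pred Carrier (c ⊔ ℓ₁ ⊔ ℓ₂) → Pred Carrier (c ⊔ ℓ₁ ⊔ ℓ₂)
  IsUpperBound S b = ∀ x → S x → x ≤ b

  field
    complete     : ∀ (S : Pred Carrier (c ⊔ ℓ₁ ⊔ ℓ₂)) → ∃ S → ∃ (IsUpperBound S) →
                   ∃ λ s → IsUpperBound S s × (∀ b → IsUpperBound S b → s ≤ b)

  open IsTotalOrder isTotalOrder public
    using (total; antisym)
    renaming (refl to ≤-refl; reflexive to ≤-reflexive; trans to ≤-trans)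
  open NonStrictToStrict _≈_ _≤_ public using (_<_)

  infixl 7 _/_
  _/_ : Carrier → Carrier → Carrier
  x / y = x * y ⁻¹

module _ {c ℓ₁ ℓ₂} (ℝ : Reals c ℓ₁ ℓ₂) where
  open Reals ℝ
  open Sum +-monoid using (sum)

  -- Finite simple graphs with positive edge weights.  An undirected edge
  -- is recorded once, as the pair of its endpoints in increasing order.

  record WeightedGraph : Set (c ⊔ ℓ₁ ⊔ ℓ₂) where
    field
      #vertices     : ℕ
      #edges        : ℕ
      endpoints     : Fin #edges → Fin #vertices × Fin #vertices
      ordered       : ∀ e → proj₁ (endpoints e) Fin.< proj₂ (endpoints e)
      noParallel    : Injective _≡_ _≡_ endpoints
      edgeWeight    : Fin #edges → Carrier
      weight-pos    : ∀ e → 0# < edgeWeight e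

    Edge : Set
    Edge = Fin #edges

    infix 4 _isEndpointOf_
    _isEndpointOf_ : Fin #vertices → Edge → Set
    v isEndpointOf e = v ≡ proj₁ (endpoints e) ⊎ v ≡ proj₂ (endpoints e)

    IsMatching : Subset #edges → Set
    IsMatching M = ∀ {e f v} → e ∈ M → f ∈ M →
                   v isEndpointOf e → v isEndpointOf f → e ≡ f

    weight : Subset #edges → Carrier
    weight M = sum λ e → if lookup M e then edgeWeight e else 0#

    -- Edge sets such as a union over an arbitrary index type are given
    -- as predicates.

    IsMatchingIn : ∀ {a} → Pred Edge a → Subset #edges → Set a
    IsMatchingIn F M = IsMatching M × (∀ {e} → e ∈ M → F e)

    IsMaxWeightMatching : ∀ {a} → Pred Edge a → Subset #edges → Set (a ⊔ ℓ₂)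
    IsMaxWeightMatching F M =
      IsMatchingIn F M × (∀ N → IsMatchingIn F N → weight N ≤ weight M)

    -- The edge set of G[l,r].
    EdgesBetween : Carrier → Carrier → Pred Edge ℓ₂
    EdgesBetween l r e = l ≤ edgeWeight e × edgeWeight e ≤ r

    ⋃ : ∀ {ι} {I : Set ι} → (I → Subset #edges) → Pred Edge ι
    ⋃ M e = ∃ λ i → e ∈ M i

  maximum-exists : (∀ {a} → ExcludedMiddle a) →
                   ∀ {p} n (w : Subset n → Carrier) (P : Pred (Subset n) p) → ∃ P →
                   ∃ λ M → P M × (∀ N → P N → w N ≤ w M)
  maximum-exists em zero    w P ([] , p) = [] , p , λ { [] _ → ≤-refl }
  maximum-exists em (suc n) w P ∃P
    with em {P = ∃ λ M → P (inside ∷ M)} | em {P = ∃ λ M → P (outside ∷ M)}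
  ... | no ∄i | no ∄o = ⊥-elim (case ∃P)
    where
    case : ¬ ∃ P
    case (inside  ∷ M , p) = ∄i (M , p)
    case (outside ∷ M , p) = ∄o (M , p)
  ... | yes ∃i | no ∄o
    with A , pA , maxA ← maximum-exists em n (λ M → w (inside ∷ M)) (λ M → P (inside ∷ M)) ∃i
    = inside ∷ A , pA , λ
      { (inside  ∷ N) p → maxA N p
      ; (outside ∷ N) p → ⊥-elim (∄o (N , p)) }
  ... | no ∄i | yes ∃o
    with B , pB , maxB ← maximum-exists em n (λ M → w (outside ∷ M)) (λ M → P (outside ∷ M)) ∃o
    = outside ∷ B , pB , λ
      { (inside  ∷ N) p → ⊥-elim (∄i (N , p))
      ; (outside ∷ N) p → maxB N p }
  ... | yes ∃i | yes ∃o
    with A , pA , maxA ← maximum-exists em n (λ M → w (inside ∷ M)) (λ M → P (inside ∷ M)) ∃i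
       | B , pB , maxB ← maximum-exists em n (λ M → w (outside ∷ M)) (λ M → P (outside ∷ M)) ∃o
    with total (w (inside ∷ A)) (w (outside ∷ B))
  ... | inj₁ A≤B = outside ∷ B , pB , λ
      { (inside  ∷ N) p → ≤-trans (maxA N p) A≤B
      ; (outside ∷ N) p → maxB N p }
  ... | inj₂ B≤A = inside ∷ A , pA , λ
      { (inside  ∷ N) p → maxA N p
      ; (outside ∷ N) p → ≤-trans (maxB N p) B≤A }

  -- Excluded middle is needed because an edge set need not be decidable.
  -- The empty matching is always allowed, so the maximum weight is zero
  -- when F has no edges.

  module _ (em : ∀ {a} → ExcludedMiddle a) (G : WeightedGraph) where
    open WeightedGraph G

    maxWeightMatching : ∀ {a} (F : Pred Edge a) → ∃ (IsMaxWeightMatching F)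
    maxWeightMatching F =
      maximum-exists em #edges weight (IsMatchingIn F)
        (Subset.⊥ , (λ e∈⊥ → ⊥-elim (∉⊥ e∈⊥)) , λ e∈⊥ → ⊥-elim (∉⊥ e∈⊥))

    μ : ∀ {a} → Pred Edge a → Carrier
    μ F = weight (proj₁ (maxWeightMatching F))

{-# OPTIONS --safe #-}

-- Let G be the path with three edges of weights 1, 1, m, where
-- R < m < 1/ε - 1.  No admissible interval contains both 1 and m, so every
-- interval containing 1 may choose the middle edge; the first edge is then
-- never chosen.  The middle and last edges meet, so the union carries at most
-- m, while μ(G) ≥ 1 + m; and m < (1 - ε)(1 + m) since ε (1 + m) < 1.

module Submission where

open import Defs
open import Axiom.ExcludedMiddle using (ExcludedMiddle)
open import Data.Empty using (⊥-elim)
open import Data.Fin.Base using (Fin; inject₁) renaming (suc to fsuc)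
open import Data.Fin.Patterns using (0F; 1F; 2F)
open import Data.Fin.Properties using (suc-injective; toℕ-inject₁)
open import Data.Fin.Subset using (Subset; _∈_; _∉_; inside; outside; ⁅_⁆)
open import Data.Fin.Subset.Properties using (x∈⁅y⁆⇒x≡y)
open import Data.Nat.Base using (s≤s)
import Data.Nat.Properties as ℕ
open import Data.Product.Base using (Σ; ∃; _×_; _,_; proj₁; proj₂)
open import Data.Sum.Base using (inj₁; inj₂)
open import Data.Vec.Base using ([]; _∷_; here; there)
open import Level using (Level)
open import Relation.Binary.Bundles using (Poset)
open import Relation.Binary.PropositionalEquality.Core using (refl; sym; trans; cong)
open import Relation.Binary.Structures using (IsTotalOrder)
open import Relation.Nullary using (¬_; yes; no)
open import Relation.Unary using (U)
import Algebra.Properties.Ring as RingProperties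
import Relation.Binary.Construct.NonStrictToStrict as NonStrictToStrict
import Relation.Binary.Reasoning.PartialOrder as PartialOrderReasoning

-- Order and arithmetic in an ordered field.

module OrderedField {c ℓ₁ ℓ₂} (ℝ : Reals c ℓ₁ ℓ₂) where
  open Reals ℝ hiding (refl; sym; trans)
  module ≈ = Reals ℝ
  open RingProperties ring using (-1*x≈-x; -‿distribˡ-*; -‿involutive)
  open NonStrictToStrict _≈_ _≤_ using (<⇒≱; ≰⇒>)

  ≤-poset : Poset c ℓ₁ ℓ₂
  ≤-poset = record { isPartialOrder = IsTotalOrder.isPartialOrder isTotalOrder }

  open PartialOrderReasoning ≤-poset

  <⇒¬≥ : ∀ {x y} → x < y → ¬ y ≤ x
  <⇒¬≥ = <⇒≱ antisym

  -- Since `<` means `≤` together with `¬ ≈`, totality turns a refuted inequality into a strict one.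
  -- Several strict bounds below are obtained by contradiction in this way.
  ¬≥⇒< : ∀ {x y} → ¬ y ≤ x → x < y
  ¬≥⇒< = ≰⇒> ≈.sym ≤-reflexive total

  +-monoʳ-≤ : ∀ z {x y} → x ≤ y → z + x ≤ z + y
  +-monoʳ-≤ z {x} {y} x≤y = begin
    z + x ≈⟨ +-comm z x ⟩
    x + z ≤⟨ +-monoˡ-≤ z x≤y ⟩
    y + z ≈⟨ +-comm y z ⟩
    z + y ∎

  +-mono-≤ : ∀ {u v x y} → u ≤ v → x ≤ y → u + x ≤ v + y
  +-mono-≤ u≤v x≤y = ≤-trans (+-monoˡ-≤ _ u≤v) (+-monoʳ-≤ _ x≤y)

  x+y-y≈x : ∀ x y → (x + y) - y ≈ x
  x+y-y≈x x y = begin-equality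
    (x + y) - y   ≈⟨ +-assoc x y (- y) ⟩
    x + (y - y)   ≈⟨ +-congˡ (-‿inverseʳ y) ⟩
    x + 0#        ≈⟨ +-identityʳ x ⟩
    x             ∎

  x-y+y≈x : ∀ x y → (x - y) + y ≈ x
  x-y+y≈x x y = begin-equality
    (x - y) + y     ≈⟨ +-assoc x (- y) y ⟩
    x + (- y + y)   ≈⟨ +-congˡ (-‿inverseˡ y) ⟩
    x + 0#          ≈⟨ +-identityʳ x ⟩
    x               ∎

  +-cancelʳ-≤ : ∀ z {x y} → x + z ≤ y + z → x ≤ y
  +-cancelʳ-≤ z {x} {y} x+z≤y+z = begin
    x             ≈⟨ x+y-y≈x x z ⟨
    (x + z) - z   ≤⟨ +-monoˡ-≤ (- z) x+z≤y+z ⟩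
    (y + z) - z   ≈⟨ x+y-y≈x y z ⟩
    y             ∎

  x≤y⇒0≤y-x : ∀ {x y} → x ≤ y → 0# ≤ y - x
  x≤y⇒0≤y-x {x} {y} x≤y = begin
    0#      ≈⟨ -‿inverseʳ x ⟨
    x - x   ≤⟨ +-monoˡ-≤ (- x) x≤y ⟩
    y - x   ∎

  -- `*-nonNeg` applies to `z` and `y - x`; adding `z * x` to both sides gives the claim.
  *-monoˡ-≤-nonNeg : ∀ {x y z} → 0# ≤ z → x ≤ y → z * x ≤ z * y
  *-monoˡ-≤-nonNeg {x} {y} {z} 0≤z x≤y = begin
    z * x                   ≈⟨ +-identityˡ (z * x) ⟨
    0# + z * x              ≤⟨ +-monoˡ-≤ (z * x) (*-nonNeg 0≤z (x≤y⇒0≤y-x x≤y)) ⟩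
    z * (y - x) + z * x     ≈⟨ distribˡ z (y - x) x ⟨
    z * ((y - x) + x)       ≈⟨ *-congˡ (x-y+y≈x y x) ⟩
    z * y                   ∎

  *-monoʳ-≤-nonNeg : ∀ {x y z} → 0# ≤ z → x ≤ y → x * z ≤ y * z
  *-monoʳ-≤-nonNeg {x} {y} {z} 0≤z x≤y = begin
    x * z ≈⟨ *-comm x z ⟩
    z * x ≤⟨ *-monoˡ-≤-nonNeg 0≤z x≤y ⟩
    z * y ≈⟨ *-comm z y ⟩
    y * z ∎

  0≤1 : 0# ≤ 1#
  0≤1 with total 0# 1#
  ... | inj₁ 0≤1 = 0≤1
  -- Here `- 1#` is nonnegative, hence so is its square, which is `1#`.
  ... | inj₂ 1≤0 = begin
    0#            ≤⟨ *-nonNeg 0≤-1 0≤-1 ⟩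
    - 1# * - 1#   ≈⟨ -1*x≈-x (- 1#) ⟩
    - - 1#        ≈⟨ -‿involutive 1# ⟩
    1#            ∎
    where
    0≤-1 : 0# ≤ - 1#
    0≤-1 = ≤-trans (x≤y⇒0≤y-x 1≤0) (≤-reflexive (+-identityˡ (- 1#)))

  0<1 : 0# < 1#
  0<1 = 0≤1 , λ 0≈1 → 1≉0 (≈.sym 0≈1)

  x≤y+x : ∀ {y} x → 0# ≤ y → x ≤ y + x
  x≤y+x {y} x 0≤y = begin
    x        ≈⟨ +-identityˡ x ⟨
    0# + x   ≤⟨ +-monoˡ-≤ x 0≤y ⟩
    y + x    ∎

  2≉0 : ¬ 1# + 1# ≈ 0#
  2≉0 2≈0 = <⇒¬≥ 0<1 (≤-trans (x≤y+x 1# 0≤1) (≤-reflexive 2≈0))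

  -- Supplies the weight of the last edge, strictly between `R` and `ε ⁻¹ - 1#`. The witness is the
  -- midpoint; doubling either reverse inequality and cancelling would give `y ≤ x`.
  <-dense : ∀ {x y} → x < y → ∃ λ m → x < m × m < y
  <-dense {x} {y} x<y = m , ¬≥⇒< m≰x , ¬≥⇒< y≰m
    where
    m = (x + y) / (1# + 1#)

    m+m≈x+y : m + m ≈ x + y
    m+m≈x+y = begin-equality
      m + m                                         ≈⟨ +-cong (*-identityʳ m) (*-identityʳ m) ⟨
      m * 1# + m * 1#                               ≈⟨ distribˡ m 1# 1# ⟨
      m * (1# + 1#)                                 ≈⟨ *-assoc _ _ _ ⟩
      (x + y) * ((1# + 1#) ⁻¹ * (1# + 1#))          ≈⟨ *-congˡ (*-comm _ _) ⟩
      (x + y) * ((1# + 1#) * (1# + 1#) ⁻¹)          ≈⟨ *-congˡ (*-inverseʳ 2≉0) ⟩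
      (x + y) * 1#                                  ≈⟨ *-identityʳ _ ⟩
      x + y                                         ∎

    m≰x : ¬ m ≤ x
    m≰x m≤x = <⇒¬≥ x<y (+-cancelʳ-≤ x (begin
      y + x   ≈⟨ +-comm y x ⟩
      x + y   ≈⟨ m+m≈x+y ⟨
      m + m   ≤⟨ +-mono-≤ m≤x m≤x ⟩
      x + x   ∎))

    y≰m : ¬ y ≤ m
    y≰m y≤m = <⇒¬≥ x<y (+-cancelʳ-≤ y (begin
      y + y   ≤⟨ +-mono-≤ y≤m y≤m ⟩
      m + m   ≈⟨ m+m≈x+y ⟩
      x + y   ∎))

  -- Inequalities linking `ε`, `R` and the weight `m`.

  x/y*y≈x : ∀ {x y} → 0# < y → x / y * y ≈ x
  x/y*y≈x {x} {y} (_ , 0≉y) = begin-equality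
    x * y ⁻¹ * y     ≈⟨ *-assoc x (y ⁻¹) y ⟩
    x * (y ⁻¹ * y)   ≈⟨ *-congˡ (*-comm (y ⁻¹) y) ⟩
    x * (y * y ⁻¹)   ≈⟨ *-congˡ (*-inverseʳ λ y≈0 → 0≉y (≈.sym y≈0)) ⟩
    x * 1#           ≈⟨ *-identityʳ x ⟩
    x                ∎

  -- An admissible interval that starts at or below `1#` ends by `R`, hence before `m`: `r` equals
  -- `r / l * l`, and both factors are bounded in turn.
  r/l≤R∧l≤1⇒r≤R : ∀ {l r R} → 0# ≤ R → 0# < l → r / l ≤ R → l ≤ 1# → r ≤ R
  r/l≤R∧l≤1⇒r≤R {l} {r} {R} 0≤R 0<l r/l≤R l≤1 = begin
    r           ≈⟨ x/y*y≈x 0<l ⟨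
    r / l * l   ≤⟨ *-monoʳ-≤-nonNeg (proj₁ 0<l) r/l≤R ⟩
    R * l       ≤⟨ *-monoˡ-≤-nonNeg 0≤R l≤1 ⟩
    R * 1#      ≈⟨ *-identityʳ R ⟩
    R           ∎

  x<y⁻¹-1⇒y*[1+x]<1 : ∀ {x y} → 0# < y → x < y ⁻¹ - 1# → y * (1# + x) < 1#
  x<y⁻¹-1⇒y*[1+x]<1 {x} {y} (0≤y , 0≉y) (x≤ , x≉) = yx≤1 , yx≉1
    where
    yy⁻¹≈1 : y * y ⁻¹ ≈ 1#
    yy⁻¹≈1 = *-inverseʳ λ y≈0 → 0≉y (≈.sym y≈0)

    yx≤1 : y * (1# + x) ≤ 1#
    yx≤1 = begin
      y * (1# + x)              ≈⟨ *-congˡ (+-comm 1# x) ⟩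
      y * (x + 1#)              ≤⟨ *-monoˡ-≤-nonNeg 0≤y (+-monoˡ-≤ 1# x≤) ⟩
      y * ((y ⁻¹ - 1#) + 1#)    ≈⟨ *-congˡ (x-y+y≈x (y ⁻¹) 1#) ⟩
      y * y ⁻¹                  ≈⟨ yy⁻¹≈1 ⟩
      1#                        ∎

    -- Strictness is a separate claim: in case of equality, multiplying by `y ⁻¹` recovers
    -- `x ≈ y ⁻¹ - 1#`.
    yx≉1 : ¬ y * (1# + x) ≈ 1#
    yx≉1 yx≈1 = x≉ (begin-equality
      x                                ≈⟨ x+y-y≈x x 1# ⟨
      (x + 1#) - 1#                    ≈⟨ +-congʳ (+-comm x 1#) ⟩
      (1# + x) - 1#                    ≈⟨ +-congʳ (*-identityˡ (1# + x)) ⟨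
      1# * (1# + x) - 1#               ≈⟨ +-congʳ (*-congʳ yy⁻¹≈1) ⟨
      y * y ⁻¹ * (1# + x) - 1#         ≈⟨ +-congʳ (*-congʳ (*-comm y (y ⁻¹))) ⟩
      y ⁻¹ * y * (1# + x) - 1#         ≈⟨ +-congʳ (*-assoc (y ⁻¹) y (1# + x)) ⟩
      y ⁻¹ * (y * (1# + x)) - 1#       ≈⟨ +-congʳ (*-congˡ yx≈1) ⟩
      y ⁻¹ * 1# - 1#                   ≈⟨ +-congʳ (*-identityʳ (y ⁻¹)) ⟩
      y ⁻¹ - 1#                        ∎)

  [1-x]*y≈y-x*y : ∀ x y → (1# - x) * y ≈ y - x * y
  [1-x]*y≈y-x*y x y = begin-equality
    (1# - x) * y         ≈⟨ distribʳ y 1# (- x) ⟩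
    1# * y + - x * y     ≈⟨ +-cong (*-identityˡ y) (≈.sym (-‿distribˡ-* x y)) ⟩
    y - x * y            ∎

  -- The right side is `(1# + y) - x * (1# + y)`, and less than `1#` is subtracted from `1# + y`.
  -- This is the source of the strict inequality in the theorem.
  x*[1+y]<1⇒y<[1-x]*[1+y] : ∀ {x y} → x * (1# + y) < 1# → y < (1# - x) * (1# + y)
  x*[1+y]<1⇒y<[1-x]*[1+y] {x} {y} xy<1 = ¬≥⇒< λ ≤y → <⇒¬≥ xy<1 (+-cancelʳ-≤ y (begin
    1# + y                                            ≈⟨ x-y+y≈x (1# + y) (x * (1# + y)) ⟨
    ((1# + y) - x * (1# + y)) + x * (1# + y)          ≈⟨ +-congʳ ([1-x]*y≈y-x*y x (1# + y)) ⟨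
    (1# - x) * (1# + y) + x * (1# + y)                ≤⟨ +-monoˡ-≤ _ ≤y ⟩
    y + x * (1# + y)                                  ≈⟨ +-comm y _ ⟩
    x * (1# + y) + y                                  ∎))

  -- Because `1# ≤ y + 1#`, `x` is at most `x * (1# + y)`. With `x` as `ε`, this allows a lower
  -- bound on `μ` to be multiplied by `1# - ε`.
  x*[1+y]≤1⇒0≤1-x : ∀ {x y} → 0# ≤ x → 0# ≤ y → x * (1# + y) ≤ 1# → 0# ≤ 1# - x
  x*[1+y]≤1⇒0≤1-x {x} {y} 0≤x 0≤y xy≤1 = x≤y⇒0≤y-x (begin
    x              ≈⟨ *-identityʳ x ⟨
    x * 1#         ≤⟨ *-monoˡ-≤-nonNeg 0≤x (x≤y+x 1# 0≤y) ⟩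
    x * (y + 1#)   ≈⟨ *-congˡ (+-comm y 1#) ⟩
    x * (1# + y)   ≤⟨ xy≤1 ⟩
    1#             ∎)

-- The weighted path and its matchings.

module Path {c ℓ₁ ℓ₂} (ℝ : Reals c ℓ₁ ℓ₂) (m : Reals.Carrier ℝ) (1≤m : Reals._≤_ ℝ (Reals.1# ℝ) m) where
  open Reals ℝ hiding (refl; sym; trans)
  open OrderedField ℝ
  open PartialOrderReasoning ≤-poset

  0≤m : 0# ≤ m
  0≤m = ≤-trans 0≤1 1≤m

  pathWeight : Fin 3 → Carrier
  pathWeight 0F = 1#
  pathWeight 1F = 1#
  pathWeight 2F = m

  path : WeightedGraph ℝ
  path = record
    { #vertices  = 4
    ; #edges     = 3
    -- Edge `e` joins vertices `e` and `e + 1`, so its second endpoint already determines it.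
    ; endpoints  = λ e → inject₁ e , fsuc e
    ; ordered    = λ e → s≤s (ℕ.≤-reflexive (toℕ-inject₁ e))
    ; noParallel = λ eq → suc-injective (cong proj₂ eq)
    ; edgeWeight = pathWeight
    ; weight-pos = λ
      { 0F → 0<1
      ; 1F → 0<1
      ; 2F → ¬≥⇒< λ m≤0 → <⇒¬≥ 0<1 (≤-trans 1≤m m≤0) }
    }

  open WeightedGraph path

  -- In the next two lemmas the excluded edge leaves two adjacent edges,
  -- so at most one summand is nonzero.

  weight≤1 : ∀ N → IsMatching N → 2F ∉ N → weight N ≤ 1#
  weight≤1 (_ ∷ _ ∷ inside ∷ []) _ 2∉N = ⊥-elim (2∉N (there (there here)))
  weight≤1 (inside ∷ inside ∷ outside ∷ []) matching _
    with () ← matching {v = 1F} here (there here) (inj₂ refl) (inj₁ refl)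
  weight≤1 (inside ∷ outside ∷ outside ∷ []) _ _ = begin
    1# + (0# + (0# + 0#))  ≈⟨ +-congˡ (+-identityˡ _) ⟩
    1# + (0# + 0#)         ≈⟨ +-congˡ (+-identityˡ _) ⟩
    1# + 0#                ≈⟨ +-identityʳ 1# ⟩
    1#                     ∎
  weight≤1 (outside ∷ inside ∷ outside ∷ []) _ _ = begin
    0# + (1# + (0# + 0#))  ≈⟨ +-identityˡ _ ⟩
    1# + (0# + 0#)         ≈⟨ +-congˡ (+-identityˡ _) ⟩
    1# + 0#                ≈⟨ +-identityʳ 1# ⟩
    1#                     ∎
  weight≤1 (outside ∷ outside ∷ outside ∷ []) _ _ = begin
    0# + (0# + (0# + 0#))  ≈⟨ +-identityˡ _ ⟩
    0# + (0# + 0#)         ≈⟨ +-identityˡ _ ⟩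
    0# + 0#                ≈⟨ +-identityˡ _ ⟩
    0#                     ≤⟨ 0≤1 ⟩
    1#                     ∎

  weight≤m : ∀ N → IsMatching N → 0F ∉ N → weight N ≤ m
  weight≤m (inside ∷ _ ∷ _ ∷ []) _ 0∉N = ⊥-elim (0∉N here)
  weight≤m (outside ∷ inside ∷ inside ∷ []) matching _
    with () ← matching {v = 2F} (there here) (there (there here)) (inj₂ refl) (inj₁ refl)
  weight≤m (outside ∷ b ∷ outside ∷ []) matching _ =
    ≤-trans (weight≤1 (outside ∷ b ∷ outside ∷ []) matching λ { (there (there ())) }) 1≤m
  weight≤m (outside ∷ outside ∷ inside ∷ []) _ _ = begin
    0# + (0# + (m + 0#))   ≈⟨ +-identityˡ _ ⟩
    0# + (m + 0#)          ≈⟨ +-identityˡ _ ⟩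
    m + 0#                 ≈⟨ +-identityʳ m ⟩
    m                      ∎

  outerEdges : Subset 3
  outerEdges = inside ∷ outside ∷ inside ∷ []

  -- The first edge has vertices 0 and 1, the last 2 and 3, so every mixed case is absurd.
  outerEdges-isMatching : IsMatching outerEdges
  outerEdges-isMatching here here _ _ = refl
  outerEdges-isMatching (there (there here)) (there (there here)) _ _ = refl
  outerEdges-isMatching here (there (there here)) (inj₁ refl) (inj₁ ())
  outerEdges-isMatching here (there (there here)) (inj₁ refl) (inj₂ ())
  outerEdges-isMatching here (there (there here)) (inj₂ refl) (inj₁ ())
  outerEdges-isMatching here (there (there here)) (inj₂ refl) (inj₂ ())
  outerEdges-isMatching (there (there here)) here (inj₁ refl) (inj₁ ())
  outerEdges-isMatching (there (there here)) here (inj₁ refl) (inj₂ ())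
  outerEdges-isMatching (there (there here)) here (inj₂ refl) (inj₁ ())
  outerEdges-isMatching (there (there here)) here (inj₂ refl) (inj₂ ())

  1+m≤weight-outerEdges : 1# + m ≤ weight outerEdges
  1+m≤weight-outerEdges = begin
    1# + m                   ≈⟨ +-congˡ (+-identityʳ m) ⟨
    1# + (m + 0#)            ≈⟨ +-congˡ (+-identityˡ _) ⟨
    1# + (0# + (m + 0#))     ∎

  middle-isMatching : IsMatching ⁅ 1F ⁆
  middle-isMatching e∈ f∈ _ _ = trans (x∈⁅y⁆⇒x≡y 1F e∈) (sym (x∈⁅y⁆⇒x≡y 1F f∈))

  1≤weight-middle : 1# ≤ weight ⁅ 1F ⁆
  1≤weight-middle = begin
    1#                       ≈⟨ +-identityʳ 1# ⟨
    1# + 0#                  ≈⟨ +-congˡ (+-identityˡ _) ⟨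
    1# + (0# + 0#)           ≈⟨ +-identityˡ _ ⟨
    0# + (1# + (0# + 0#))    ∎

  -- With `m` beyond `r`, every competitor lacks the last edge and weighs at most `1#`, which the
  -- middle edge attains. The first edge alone ties with it, and the tie is broken towards the
  -- middle.
  middle-isMaxWeightMatching : ∀ {l r} → l ≤ 1# → 1# ≤ r → ¬ m ≤ r →
                               IsMaxWeightMatching (EdgesBetween l r) ⁅ 1F ⁆
  middle-isMaxWeightMatching {l} {r} l≤1 1≤r m≰r = (middle-isMatching , inRange) , maximal
    where
    inRange : ∀ {e} → e ∈ ⁅ 1F ⁆ → EdgesBetween l r e
    inRange e∈ with refl ← x∈⁅y⁆⇒x≡y 1F e∈ = l≤1 , 1≤r

    maximal : ∀ N → IsMatchingIn (EdgesBetween l r) N → weight N ≤ weight ⁅ 1F ⁆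
    maximal N (matching , N⊆[l,r]) =
      ≤-trans (weight≤1 N matching λ 2∈N → m≰r (proj₂ (N⊆[l,r] 2∈N))) 1≤weight-middle

  -- Choosing matchings, and bounds on `μ`.

  module _ (em : ∀ {a} → ExcludedMiddle a) where

    -- If `1#` lies in the interval, the middle edge is chosen. Otherwise the first edge is absent
    -- from the subgraph, and any maximum matching avoids it.
    maxWeightMatchingAvoidingFirst :
      ∀ l r → (l ≤ 1# → ¬ m ≤ r) →
      ∃ λ M → IsMaxWeightMatching (EdgesBetween l r) M × 0F ∉ M
    maxWeightMatchingAvoidingFirst l r narrow with em {P = EdgesBetween l r 0F}
    ... | yes (l≤1 , 1≤r) =
      ⁅ 1F ⁆ , middle-isMaxWeightMatching l≤1 1≤r (narrow l≤1) , λ ()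
    ... | no 0∉[l,r] with M , max ← maxWeightMatching ℝ em path (EdgesBetween l r) =
      M , max , λ 0∈M → 0∉[l,r] (proj₂ (proj₁ max) 0∈M)

    -- The maximiser inside `F` is itself a matching without the first edge, so `weight≤m` applies
    -- to it.
    μ≤m : ∀ {a} (F : Edge → Set a) → ¬ F 0F → μ ℝ em path F ≤ m
    μ≤m F ¬F0 with N , (matching , N⊆F) , _ ← maxWeightMatching ℝ em path F =
      weight≤m N matching λ 0∈N → ¬F0 (N⊆F 0∈N)

    -- The outer edges compete for the maximum over the whole path.
    1+m≤μ : 1# + m ≤ μ ℝ em path U
    1+m≤μ with _ , _ , max ← maxWeightMatching ℝ em path U =
      ≤-trans 1+m≤weight-outerEdges (max outerEdges (outerEdges-isMatching , _))

-- Fixing `m` and comparing the two maxima.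

lemma2p6 : (em : ∀ {a} → ExcludedMiddle a) →
    ∀ {c ℓ₁ ℓ₂ ι : Level} (ℝ : Reals c ℓ₁ ℓ₂) →
    let open Reals ℝ in
    (ε R : Carrier) → 0# < ε → ε < 1# / (1# + 1#) → 1# ≤ R → R < ε ⁻¹ - 1# →
    Σ (WeightedGraph ℝ) λ G →
    let open WeightedGraph G in
    (I : Set ι) (ℓ r : I → Carrier) →
    (∀ i → 0# < ℓ i) → (∀ i → r i / ℓ i ≤ R) →
    Σ (I → Subset #edges) λ M →
    (∀ i → IsMaxWeightMatching (EdgesBetween (ℓ i) (r i)) (M i)) ×
    μ ℝ em G (⋃ M) < (1# - ε) * μ ℝ em G U
lemma2p6 em ℝ ε R 0<ε _ 1≤R R<ε⁻¹-1 = path , λ I ℓ r 0<ℓ r/ℓ≤R →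
  let
    narrow : ∀ i → ℓ i ≤ 1# → ¬ m ≤ r i
    -- An interval containing both weights would give `m ≤ r i ≤ R`, against `R < m`.
    narrow i ℓ≤1 m≤r =
      <⇒¬≥ R<m (≤-trans m≤r (r/l≤R∧l≤1⇒r≤R (≤-trans 0≤1 1≤R) (0<ℓ i) (r/ℓ≤R i) ℓ≤1))

    choice = λ i → maxWeightMatchingAvoidingFirst em (ℓ i) (r i) (narrow i)
    M      = λ i → proj₁ (choice i)
  in M , (λ i → proj₁ (proj₂ (choice i))) , (begin-strict
    -- No chosen matching contains the first edge, so neither does their union.
    μ ℝ em path (⋃ M)            ≤⟨ μ≤m em (⋃ M) (λ (i , 0∈M) → proj₂ (proj₂ (choice i)) 0∈M) ⟩
    m                            <⟨ x*[1+y]<1⇒y<[1-x]*[1+y] ε[1+m]<1 ⟩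
    (1# - ε) * (1# + m)          ≤⟨ *-monoˡ-≤-nonNeg 0≤1-ε (1+m≤μ em) ⟩
    (1# - ε) * μ ℝ em path U     ∎)
  where
  open Reals ℝ using (_≤_; _<_; _+_; _*_; _-_; _⁻¹; 1#; 0#; ≤-trans)
  open OrderedField ℝ

  -- `m` depends only on `ε` and `R`, so the graph is fixed before the intervals are given.
  between = <-dense R<ε⁻¹-1
  m       = proj₁ between
  R<m     = proj₁ (proj₂ between)

  ε[1+m]<1 : ε * (1# + m) < 1#
  ε[1+m]<1 = x<y⁻¹-1⇒y*[1+x]<1 0<ε (proj₂ (proj₂ between))

  open Path ℝ m (≤-trans 1≤R (proj₁ R<m))
  open WeightedGraph path using (⋃)
  open PartialOrderReasoning ≤-poset

  0≤1-ε : 0# ≤ 1# - ε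
  0≤1-ε = x*[1+y]≤1⇒0≤1-x (proj₁ 0<ε) 0≤m (proj₁ ε[1+m]<1)
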